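{- Fix a positive integer $k$. For any $0<\varepsilon<1/10$ and any graph $G$ with $\mathrm{lcr}(G)\geq 10\log(1/\varepsilon)/\varepsilon^{2}$, $$\mathrm{lcr}_k(G)\leq \left(\frac{1}{k}+\varepsilon\right)\mathrm{lcr}(G).$$
   Context: Graphs are finite and simple, and $\log$ is the natural logarithm. A drawing of $G$ maps the vertices to distinct points of the plane and each edge to a continuous curve connecting the images of its endpoints, such that (1) no curve contains the image of any vertex other than its endpoints, (2) no two curves share infinitely many points, (3) no two curves are tangent to each other, (4) no three curves pass through the same point (other than a common endpoint). A crossing is a point, not a common endpoint, where the images of two edges intersect. The local crossing number $\mathrm{lcr}(G)$ is the smallest integer $L\ge 0$ for which there is a drawing of $G$ with at most $L$ crossings along any edge. For a positive integer $k$, the $k$-planar local crossing number $\mathrm{lcr}_k(G)$ is the minimum of $\max\{\mathrm{lcr}(G_1),\dots,\mathrm{lcr}(G_k)\}$ over all subgraphs $G_1,\dots,G_k$ of $G$ with $\bigcup_{i=1}^k E(G_i)=E(G)$. -}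

module Defs where

open import Data.Fin.Base as Fin using (Fin)
open import Data.Fin.Subset using (Subset; _∈_; _⊆_)
open import Data.Integer.Base as ℤ using (+_)
open import Data.List.Base using (List; length)
open import Data.List.Relation.Unary.Any using (Any)
open import Data.Nat.Base as ℕ using (ℕ; zero; suc; _!)
import Data.Nat.Properties as ℕₚ
open import Data.Product.Base using (Σ-syntax; ∃-syntax; _×_; _,_; proj₁; proj₂)
open import Data.Rational.Base as ℚ using (ℚ; 0ℚ; 1ℚ; ½)
import Data.Rational.Properties as ℚₚ
open import Data.Rational.Solver using (module +-*-Solver)
open import Data.Sum.Base using (_⊎_)
open import Data.Vec.Functional using (Vector; foldr)
open import Function.Bundles using (_⇔_)
open import Level using (0ℓ)
open import Relation.Binary.Core using (Rel)
open import Relation.Binary.Definitions using (Symmetric; Irreflexive; Decidable)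
open import Relation.Binary.PropositionalEquality
  using (_≡_; _≢_; refl; sym; trans; cong; cong₂; subst)
open import Relation.Nullary using (¬_)

open +-*-Solver using (solve; _:+_; _:-_; _:*_; _:=_; con)

------------------------------------------------------------------------
-- Real numbers: Cauchy sequences of rationals, with the setoid equality
-- _≈_ defined below.

IsCauchy : (ℕ → ℚ) → Set
IsCauchy x = ∀ ε → 0ℚ ℚ.< ε →
  ∃[ N ] (∀ m n → N ℕ.≤ m → N ℕ.≤ n → ℚ.∣ x m ℚ.- x n ∣ ℚ.≤ ε)

record ℝ : Set where
  constructor mkℝ
  field
    seq    : ℕ → ℚ
    cauchy : IsCauchy seq

open ℝ public

infix  4 _<_ _≤_ _≈_
infixl 6 _+_ _-_
infixl 7 _*_
infix  8 -_
infixr 9 _^_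

_<_ : Rel ℝ 0ℓ
x < y = ∃[ δ ] (0ℚ ℚ.< δ × ∃[ N ] (∀ n → N ℕ.≤ n → seq x n ℚ.+ δ ℚ.≤ seq y n))

_≤_ : Rel ℝ 0ℓ
x ≤ y = ¬ (y < x)

_≈_ : Rel ℝ 0ℓ
x ≈ y = x ≤ y × y ≤ x

private
  *-pos-ℚ : ∀ {p q} → 0ℚ ℚ.< p → 0ℚ ℚ.< q → 0ℚ ℚ.< p ℚ.* q
  *-pos-ℚ {p} {q} 0<p 0<q =
    ℚₚ.positive⁻¹ (p ℚ.* q) {{ℚₚ.pos*pos⇒pos p {{ℚ.positive 0<p}} q {{ℚ.positive 0<q}}}}

  half-pos : ∀ {ε} → 0ℚ ℚ.< ε → 0ℚ ℚ.< ½ ℚ.* ε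
  half-pos = *-pos-ℚ (ℚₚ.positive⁻¹ ½)

  halves : ∀ ε → ½ ℚ.* ε ℚ.+ ½ ℚ.* ε ≡ ε
  halves = solve 1 (λ e → con ½ :* e :+ con ½ :* e := e) refl

  max-≤ˡ : ∀ {m n k} → m ℕ.⊔ n ℕ.≤ k → m ℕ.≤ k
  max-≤ˡ {m} {n} = ℕₚ.≤-trans (ℕₚ.m≤m⊔n m n)

  max-≤ʳ : ∀ {m n k} → m ℕ.⊔ n ℕ.≤ k → n ℕ.≤ k
  max-≤ʳ {m} {n} = ℕₚ.≤-trans (ℕₚ.m≤n⊔m m n)

  *-mono-≤-ℚ : ∀ {p q r s} → 0ℚ ℚ.≤ r → 0ℚ ℚ.≤ q → p ℚ.≤ q → r ℚ.≤ s → p ℚ.* r ℚ.≤ q ℚ.* s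
  *-mono-≤-ℚ {p} {q} {r} {s} 0≤r 0≤q p≤q r≤s = ℚₚ.≤-trans
    (ℚₚ.*-monoʳ-≤-nonNeg r {{ℚ.nonNegative 0≤r}} p≤q)
    (ℚₚ.*-monoˡ-≤-nonNeg q {{ℚ.nonNegative 0≤q}} r≤s)

  inv-ℚ : ∀ q → 0ℚ ℚ.< q → ℚ
  inv-ℚ q 0<q = (ℚ.1/ q) {{ℚ.>-nonZero 0<q}}

  inv-pos : ∀ {q} (0<q : 0ℚ ℚ.< q) → 0ℚ ℚ.< inv-ℚ q 0<q
  inv-pos {q} 0<q = ℚₚ.positive⁻¹ _ {{ℚₚ.1/pos⇒pos q {{ℚ.positive 0<q}}}}

  inv-* : ∀ {q} (0<q : 0ℚ ℚ.< q) → inv-ℚ q 0<q ℚ.* q ≡ 1ℚ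
  inv-* {q} 0<q = ℚₚ.*-inverseˡ q {{ℚ.>-nonZero 0<q}}

fromℚ : ℚ → ℝ
fromℚ q = mkℝ (λ _ → q) λ ε 0<ε → 0 , λ _ _ _ _ →
  ℚₚ.≤-trans (ℚₚ.≤-reflexive (cong ℚ.∣_∣ (ℚₚ.+-inverseʳ q))) (ℚₚ.<⇒≤ 0<ε)

fromℕ : ℕ → ℝ
fromℕ n = fromℚ (+ n ℚ./ 1)

0ℝ 1ℝ : ℝ
0ℝ = fromℚ 0ℚ
1ℝ = fromℚ 1ℚ

_+_ : ℝ → ℝ → ℝ
x + y = mkℝ (λ n → seq x n ℚ.+ seq y n) +-cauchy
  where
  +-cauchy : IsCauchy (λ n → seq x n ℚ.+ seq y n)
  +-cauchy ε 0<ε with cauchy x (½ ℚ.* ε) (half-pos 0<ε) | cauchy y (½ ℚ.* ε) (half-pos 0<ε)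
  ... | M , xM | N , yN = M ℕ.⊔ N , λ m n ≤m ≤n → begin
      ℚ.∣ seq x m ℚ.+ seq y m ℚ.- (seq x n ℚ.+ seq y n) ∣
        ≡⟨ cong ℚ.∣_∣ (rearrange (seq x m) (seq y m) (seq x n) (seq y n)) ⟩
      ℚ.∣ (seq x m ℚ.- seq x n) ℚ.+ (seq y m ℚ.- seq y n) ∣
        ≤⟨ ℚₚ.∣p+q∣≤∣p∣+∣q∣ (seq x m ℚ.- seq x n) (seq y m ℚ.- seq y n) ⟩
      ℚ.∣ seq x m ℚ.- seq x n ∣ ℚ.+ ℚ.∣ seq y m ℚ.- seq y n ∣
        ≤⟨ ℚₚ.+-mono-≤ (xM m n (max-≤ˡ ≤m) (max-≤ˡ ≤n)) (yN m n (max-≤ʳ {M} ≤m) (max-≤ʳ {M} ≤n)) ⟩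
      ½ ℚ.* ε ℚ.+ ½ ℚ.* ε ≡⟨ halves ε ⟩
      ε ∎
    where
    open ℚₚ.≤-Reasoning
    rearrange : ∀ a b c d → a ℚ.+ b ℚ.- (c ℚ.+ d) ≡ (a ℚ.- c) ℚ.+ (b ℚ.- d)
    rearrange = solve 4 (λ a b c d → a :+ b :- (c :+ d) := (a :- c) :+ (b :- d)) refl

-_ : ℝ → ℝ
- x = mkℝ (λ n → ℚ.- seq x n) λ ε 0<ε →
  let N , xN = cauchy x ε 0<ε in N , λ m n ≤m ≤n →
    subst (ℚ._≤ ε)
      (trans (sym (ℚₚ.∣-p∣≡∣p∣ (seq x m ℚ.- seq x n)))
             (cong ℚ.∣_∣ (ℚₚ.neg-distrib-+ (seq x m) (ℚ.- seq x n))))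
      (xN m n ≤m ≤n)

_-_ : ℝ → ℝ → ℝ
x - y = x + (- y)

private
  eventually-bounded : ∀ x →
    ∃[ B ] (0ℚ ℚ.< B × ∃[ N ] (∀ n → N ℕ.≤ n → ℚ.∣ seq x n ∣ ℚ.≤ B))
  eventually-bounded x with cauchy x 1ℚ (ℚₚ.positive⁻¹ 1ℚ)
  ... | N , xN = 1ℚ ℚ.+ ℚ.∣ seq x N ∣
      , ℚₚ.+-mono-<-≤ (ℚₚ.positive⁻¹ 1ℚ) (ℚₚ.0≤∣p∣ (seq x N))
      , N , λ n N≤n → begin
      ℚ.∣ seq x n ∣
        ≡⟨ cong ℚ.∣_∣ (split (seq x n) (seq x N)) ⟩
      ℚ.∣ (seq x n ℚ.- seq x N) ℚ.+ seq x N ∣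
        ≤⟨ ℚₚ.∣p+q∣≤∣p∣+∣q∣ (seq x n ℚ.- seq x N) (seq x N) ⟩
      ℚ.∣ seq x n ℚ.- seq x N ∣ ℚ.+ ℚ.∣ seq x N ∣
        ≤⟨ ℚₚ.+-monoˡ-≤ ℚ.∣ seq x N ∣ (xN n N N≤n ℕₚ.≤-refl) ⟩
      1ℚ ℚ.+ ℚ.∣ seq x N ∣ ∎
    where
    open ℚₚ.≤-Reasoning
    split : ∀ a b → a ≡ (a ℚ.- b) ℚ.+ b
    split = solve 2 (λ a b → a := (a :- b) :+ b) refl

  scaled-≤ : ∀ {a B c ε} (0<B : 0ℚ ℚ.< B) → 0ℚ ℚ.≤ c →
    a ℚ.≤ B → c ℚ.≤ inv-ℚ B 0<B ℚ.* ε → a ℚ.* c ℚ.≤ ε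
  scaled-≤ {a} {B} {c} {ε} 0<B 0≤c a≤B c≤ = begin
    a ℚ.* c                    ≤⟨ *-mono-≤-ℚ 0≤c (ℚₚ.<⇒≤ 0<B) a≤B c≤ ⟩
    B ℚ.* (inv-ℚ B 0<B ℚ.* ε)  ≡⟨ solve 3 (λ b i e → b :* (i :* e) := i :* b :* e) refl B (inv-ℚ B 0<B) ε ⟩
    inv-ℚ B 0<B ℚ.* B ℚ.* ε    ≡⟨ cong (ℚ._* ε) (inv-* 0<B) ⟩
    1ℚ ℚ.* ε                   ≡⟨ ℚₚ.*-identityˡ ε ⟩
    ε ∎
    where open ℚₚ.≤-Reasoning

  product-close : ∀ {A B ε} a b c d (0<A : 0ℚ ℚ.< A) (0<B : 0ℚ ℚ.< B) →
    ℚ.∣ a ∣ ℚ.≤ A → ℚ.∣ d ∣ ℚ.≤ B →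
    ℚ.∣ b ℚ.- d ∣ ℚ.≤ inv-ℚ A 0<A ℚ.* (½ ℚ.* ε) →
    ℚ.∣ a ℚ.- c ∣ ℚ.≤ inv-ℚ B 0<B ℚ.* (½ ℚ.* ε) →
    ℚ.∣ a ℚ.* b ℚ.- c ℚ.* d ∣ ℚ.≤ ε
  product-close {A} {B} {ε} a b c d 0<A 0<B a≤A d≤B Δ₁≤ Δ₂≤ = begin
    ℚ.∣ a ℚ.* b ℚ.- c ℚ.* d ∣
      ≡⟨ cong ℚ.∣_∣ (rearrange a b c d) ⟩
    ℚ.∣ a ℚ.* (b ℚ.- d) ℚ.+ d ℚ.* (a ℚ.- c) ∣
      ≤⟨ ℚₚ.∣p+q∣≤∣p∣+∣q∣ (a ℚ.* (b ℚ.- d)) (d ℚ.* (a ℚ.- c)) ⟩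
    ℚ.∣ a ℚ.* (b ℚ.- d) ∣ ℚ.+ ℚ.∣ d ℚ.* (a ℚ.- c) ∣
      ≡⟨ cong₂ ℚ._+_ (ℚₚ.∣p*q∣≡∣p∣*∣q∣ a (b ℚ.- d)) (ℚₚ.∣p*q∣≡∣p∣*∣q∣ d (a ℚ.- c)) ⟩
    ℚ.∣ a ∣ ℚ.* ℚ.∣ b ℚ.- d ∣ ℚ.+ ℚ.∣ d ∣ ℚ.* ℚ.∣ a ℚ.- c ∣
      ≤⟨ ℚₚ.+-mono-≤
           (scaled-≤ {ℚ.∣ a ∣} {A} {ℚ.∣ b ℚ.- d ∣} {½ ℚ.* ε} 0<A (ℚₚ.0≤∣p∣ (b ℚ.- d)) a≤A Δ₁≤)
           (scaled-≤ {ℚ.∣ d ∣} {B} {ℚ.∣ a ℚ.- c ∣} {½ ℚ.* ε} 0<B (ℚₚ.0≤∣p∣ (a ℚ.- c)) d≤B Δ₂≤) ⟩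
    ½ ℚ.* ε ℚ.+ ½ ℚ.* ε
      ≡⟨ halves ε ⟩
    ε ∎
    where
    open ℚₚ.≤-Reasoning
    rearrange : ∀ a b c d → a ℚ.* b ℚ.- c ℚ.* d ≡ a ℚ.* (b ℚ.- d) ℚ.+ d ℚ.* (a ℚ.- c)
    rearrange = solve 4 (λ a b c d → a :* b :- c :* d := a :* (b :- d) :+ d :* (a :- c)) refl

_*_ : ℝ → ℝ → ℝ
x * y = mkℝ (λ n → seq x n ℚ.* seq y n) *-cauchy
  where
  *-cauchy : IsCauchy (λ n → seq x n ℚ.* seq y n)
  *-cauchy ε 0<ε =
    let A , 0<A , K , x≤A = eventually-bounded x
        B , 0<B , L , y≤B = eventually-bounded y
        M , xM = cauchy x (inv-ℚ B 0<B ℚ.* (½ ℚ.* ε)) (*-pos-ℚ (inv-pos 0<B) (half-pos 0<ε))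
        N , yN = cauchy y (inv-ℚ A 0<A ℚ.* (½ ℚ.* ε)) (*-pos-ℚ (inv-pos 0<A) (half-pos 0<ε))
    in (K ℕ.⊔ L) ℕ.⊔ (M ℕ.⊔ N) , λ m n ≤m ≤n →
      let KL≤m = max-≤ˡ ≤m
          KL≤n = max-≤ˡ ≤n
          MN≤m = max-≤ʳ {K ℕ.⊔ L} ≤m
          MN≤n = max-≤ʳ {K ℕ.⊔ L} ≤n
      in product-close {A} {B} {ε} (seq x m) (seq y m) (seq x n) (seq y n) 0<A 0<B
           (x≤A m (max-≤ˡ KL≤m)) (y≤B n (max-≤ʳ {K} KL≤n))
           (yN m n (max-≤ʳ {M} MN≤m) (max-≤ʳ {M} MN≤n))
           (xM m n (max-≤ˡ MN≤m) (max-≤ˡ MN≤n))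

-- If x is eventually at least δ > 0, its terms may be replaced by their
-- maximum with δ before inverting; only finitely many of them change.
inv : (x : ℝ) → 0ℝ < x → ℝ
inv x (δ , 0<δ , K , δ≤x) = mkℝ i inv-cauchy
  where
  c : ℕ → ℚ
  c n = seq x n ℚ.⊔ δ

  δ≤c : ∀ n → δ ℚ.≤ c n
  δ≤c n = ℚₚ.p≤q⊔p (seq x n) δ

  0<c : ∀ n → 0ℚ ℚ.< c n
  0<c n = ℚₚ.<-≤-trans 0<δ (δ≤c n)

  i : ℕ → ℚ
  i n = inv-ℚ (c n) (0<c n)

  c≡x : ∀ n → K ℕ.≤ n → c n ≡ seq x n
  c≡x n K≤n = ℚₚ.p≥q⇒p⊔q≡p (subst (ℚ._≤ seq x n) (ℚₚ.+-identityˡ δ) (δ≤x n K≤n))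

  0≤ii : ∀ m n → 0ℚ ℚ.≤ i m ℚ.* i n
  0≤ii m n = ℚₚ.<⇒≤ (*-pos-ℚ (inv-pos (0<c m)) (inv-pos (0<c n)))

  inv-cauchy : IsCauchy i
  inv-cauchy ε 0<ε with cauchy x (δ ℚ.* δ ℚ.* ε) (*-pos-ℚ (*-pos-ℚ 0<δ 0<δ) 0<ε)
  ... | N , xN = K ℕ.⊔ N , λ m n ≤m ≤n → begin
      ℚ.∣ i m ℚ.- i n ∣
        ≡⟨ cong ℚ.∣_∣ (difference m n) ⟩
      ℚ.∣ (i m ℚ.* i n) ℚ.* (c n ℚ.- c m) ∣
        ≡⟨ ℚₚ.∣p*q∣≡∣p∣*∣q∣ (i m ℚ.* i n) (c n ℚ.- c m) ⟩
      ℚ.∣ i m ℚ.* i n ∣ ℚ.* ℚ.∣ c n ℚ.- c m ∣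
        ≡⟨ cong₂ ℚ._*_ (ℚₚ.0≤p⇒∣p∣≡p (0≤ii m n))
             (cong ℚ.∣_∣ (cong₂ ℚ._-_ (c≡x n (max-≤ˡ ≤n)) (c≡x m (max-≤ˡ ≤m)))) ⟩
      i m ℚ.* i n ℚ.* ℚ.∣ seq x n ℚ.- seq x m ∣
        ≤⟨ ℚₚ.*-monoˡ-≤-nonNeg (i m ℚ.* i n) {{ℚ.nonNegative (0≤ii m n)}}
             (xN n m (max-≤ʳ {K} ≤n) (max-≤ʳ {K} ≤m)) ⟩
      i m ℚ.* i n ℚ.* (δ ℚ.* δ ℚ.* ε)
        ≤⟨ ℚₚ.*-monoˡ-≤-nonNeg (i m ℚ.* i n) {{ℚ.nonNegative (0≤ii m n)}}
             (ℚₚ.*-monoʳ-≤-nonNeg ε {{ℚ.nonNegative (ℚₚ.<⇒≤ 0<ε)}}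
               (*-mono-≤-ℚ (ℚₚ.<⇒≤ 0<δ) (ℚₚ.<⇒≤ (0<c m)) (δ≤c m) (δ≤c n))) ⟩
      i m ℚ.* i n ℚ.* (c m ℚ.* c n ℚ.* ε)
        ≡⟨ solve 5 (λ a b p q e → a :* b :* (p :* q :* e) := (a :* p) :* (b :* q) :* e)
             refl (i m) (i n) (c m) (c n) ε ⟩
      (i m ℚ.* c m) ℚ.* (i n ℚ.* c n) ℚ.* ε
        ≡⟨ cong (ℚ._* ε) (cong₂ ℚ._*_ (inv-* (0<c m)) (inv-* (0<c n))) ⟩
      1ℚ ℚ.* 1ℚ ℚ.* ε
        ≡⟨ ℚₚ.*-identityˡ ε ⟩
      ε ∎
    where
    open ℚₚ.≤-Reasoning
    difference : ∀ m n → i m ℚ.- i n ≡ (i m ℚ.* i n) ℚ.* (c n ℚ.- c m)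
    difference m n = sym (trans
      (solve 4 (λ a b p q → (a :* b) :* (q :- p) := (b :* q) :* a :- (a :* p) :* b)
        refl (i m) (i n) (c m) (c n))
      (cong₂ ℚ._-_
        (trans (cong (ℚ._* i m) (inv-* (0<c n))) (ℚₚ.*-identityˡ (i m)))
        (trans (cong (ℚ._* i n) (inv-* (0<c m))) (ℚₚ.*-identityˡ (i n)))))

infixl 7 _/_by_
_/_by_ : ℝ → (y : ℝ) → 0ℝ < y → ℝ
x / y by 0<y = x * inv y 0<y

*-pos : ∀ x y → 0ℝ < x → 0ℝ < y → 0ℝ < x * y
*-pos x y (δ , 0<δ , M , δ≤x) (η , 0<η , N , η≤y) =
  δ ℚ.* η , *-pos-ℚ 0<δ 0<η , M ℕ.⊔ N , λ n ≤n →
    let δ≤xn = subst (ℚ._≤ seq x n) (ℚₚ.+-identityˡ δ) (δ≤x n (max-≤ˡ ≤n))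
        η≤yn = subst (ℚ._≤ seq y n) (ℚₚ.+-identityˡ η) (η≤y n (max-≤ʳ {M} ≤n))
        0≤xn = ℚₚ.≤-trans (ℚₚ.<⇒≤ 0<δ) δ≤xn
    in subst (ℚ._≤ seq x n ℚ.* seq y n) (sym (ℚₚ.+-identityˡ (δ ℚ.* η)))
         (*-mono-≤-ℚ (ℚₚ.<⇒≤ 0<η) 0≤xn δ≤xn η≤yn)

fromℚ-mono-≤ : ∀ {p q} → p ℚ.≤ q → fromℚ p ≤ fromℚ q
fromℚ-mono-≤ {p} {q} p≤q (δ , 0<δ , N , h) = ℚₚ.<-irrefl refl (begin-strict
  q          ≡⟨ ℚₚ.+-identityʳ q ⟨
  q ℚ.+ 0ℚ   <⟨ ℚₚ.+-monoʳ-< q 0<δ ⟩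
  q ℚ.+ δ    ≤⟨ h N ℕₚ.≤-refl ⟩
  p          ≤⟨ p≤q ⟩
  q          ∎)
  where open ℚₚ.≤-Reasoning

_^_ : ℝ → ℕ → ℝ
x ^ zero  = 1ℝ
x ^ suc n = x * x ^ n

^-pos : ∀ x n → 0ℝ < x → 0ℝ < x ^ n
^-pos x zero    0<x = 1ℚ , ℚₚ.positive⁻¹ 1ℚ , 0 , λ _ _ → ℚₚ.≤-refl
^-pos x (suc n) 0<x = *-pos x (x ^ n) 0<x (^-pos x n 0<x)

-- Near ε x y says |x - y| < ε.
Near : ℝ → ℝ → ℝ → Set
Near ε x y = x - y < ε × y - x < ε

_⟶_ : (ℕ → ℝ) → ℝ → Set
a ⟶ x = ∀ ε → 0ℝ < ε → ∃[ N ] (∀ n → N ℕ.≤ n → Near ε (a n) x)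

-- The sum of y ^ i / i! over i < n.
expSum : ℝ → ℕ → ℝ
expSum y zero    = 0ℝ
expSum y (suc n) = expSum y n + y ^ n * fromℚ (ℚ._/_ (+ 1) (n !) {{n ℕₚ.!≢0}})

-- IsLog x y says y = log x, i.e. exp y = x for the exponential series.
IsLog : ℝ → ℝ → Set
IsLog x y = expSum y ⟶ x

------------------------------------------------------------------------
-- The plane and curves

Point : Set
Point = ℝ × ℝ

infix 4 _≈ₚ_
_≈ₚ_ : Rel Point 0ℓ
(x , y) ≈ₚ (x′ , y′) = x ≈ x′ × y ≈ y′

-- Open balls of the maximum norm.
Nearₚ : ℝ → Point → Point → Set
Nearₚ r (x , y) (x′ , y′) = Near r x x′ × Near r y y′

𝕀 : Set
𝕀 = Σ[ t ∈ ℝ ] (0ℝ ≤ t × t ≤ 1ℝ)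

0𝕀 1𝕀 : 𝕀
0𝕀 = 0ℝ , fromℚ-mono-≤ ℚₚ.≤-refl , fromℚ-mono-≤ (ℚₚ.<⇒≤ (ℚₚ.positive⁻¹ 1ℚ))
1𝕀 = 1ℝ , fromℚ-mono-≤ (ℚₚ.<⇒≤ (ℚₚ.positive⁻¹ 1ℚ)) , fromℚ-mono-≤ ℚₚ.≤-refl

-- Continuity makes `at` respect the equality of real numbers.
record Curve : Set where
  field
    at         : 𝕀 → Point
    continuous : ∀ s ε → 0ℝ < ε → ∃[ δ ] (0ℝ < δ ×
                   (∀ t → Near δ (proj₁ s) (proj₁ t) → Nearₚ ε (at s) (at t)))

open Curve public

_On_ : Point → Curve → Set
p On γ = ∃[ t ] at γ t ≈ₚ p

-- Curves are only continuous, so tangency is topological: δ meets γ at p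
-- without passing to the other side of γ.  Here δ stays at p during the
-- (usually one-point) parameter interval [a , b], and inside every disc
-- around p the points of δ just before a can be joined to those just after
-- b by a path that avoids γ.
Tangent : Curve → Curve → Point → Set
Tangent γ δ p = p On γ × Σ[ a ∈ 𝕀 ] Σ[ b ∈ 𝕀 ]
  ( 0ℝ < proj₁ a × proj₁ a ≤ proj₁ b × proj₁ b < 1ℝ
  × (∀ t → proj₁ a ≤ proj₁ t → proj₁ t ≤ proj₁ b → at δ t ≈ₚ p)
  × (∀ r → 0ℝ < r → ∃[ η ] (0ℝ < η ×
      (∀ s t → proj₁ a - η < proj₁ s → proj₁ s < proj₁ a →
               proj₁ b < proj₁ t → proj₁ t < proj₁ b + η →
         Σ[ σ ∈ Curve ] (at σ 0𝕀 ≈ₚ at δ s × at σ 1𝕀 ≈ₚ at δ t ×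
           (∀ u → Nearₚ r p (at σ u) × ¬ (at σ u On γ)))))))

-- A set of points has at most L elements when a list of length at most L
-- contains all of them.
AtMost : ℕ → (Point → Set) → Set
AtMost L P = Σ[ ps ∈ List Point ] (length ps ℕ.≤ L × (∀ p → P p → Any (p ≈ₚ_) ps))

Finite : (Point → Set) → Set
Finite P = ∃[ L ] AtMost L P

------------------------------------------------------------------------
-- Graphs

-- The vertex set is a subset of Fin n, so that a subgraph with fewer
-- vertices is again a Graph n.
record Graph (n : ℕ) : Set₁ where
  infix 4 _~_ _~?_
  field
    V        : Subset n
    _~_      : Rel (Fin n) 0ℓ
    _~?_     : Decidable _~_
    ~-sym    : Symmetric _~_
    ~-irrefl : Irreflexive _≡_ _~_
    ~⇒∈V     : ∀ {u v} → u ~ v → u ∈ V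

-- Each edge is listed once, from its smaller to its larger endpoint; the
-- proofs are irrelevant, so edges with equal endpoints are equal.
record Edge {n : ℕ} (G : Graph n) : Set where
  constructor mkEdge
  field
    src tgt  : Fin n
    .src<tgt : src Fin.< tgt
    .src~tgt : Graph._~_ G src tgt

infix 4 _∈ₑ_
_∈ₑ_ : ∀ {n} {G : Graph n} → Fin n → Edge G → Set
v ∈ₑ e = v ≡ Edge.src e ⊎ v ≡ Edge.tgt e

record _⊑_ {n : ℕ} (H G : Graph n) : Set where
  field
    V⊆V : Graph.V H ⊆ Graph.V G
    ~⇒~ : ∀ {u v} → Graph._~_ H u v → Graph._~_ G u v

------------------------------------------------------------------------
-- Drawings

-- The value of pos outside the vertex set is unconstrained and unused.
record Drawing {n : ℕ} (G : Graph n) : Set where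
  open Graph G using (V)
  field
    pos   : Fin n → Point
    curve : Edge G → Curve

  Crossing : Edge G → Edge G → Point → Set
  Crossing e f p = p On curve e × p On curve f ×
    ¬ (∃[ v ] (v ∈ₑ e × v ∈ₑ f × pos v ≈ₚ p))

  field
    pos-injective : ∀ {u v} → u ∈ V → v ∈ V → pos u ≈ₚ pos v → u ≡ v
    starts        : ∀ e → at (curve e) 0𝕀 ≈ₚ pos (Edge.src e)
    ends          : ∀ e → at (curve e) 1𝕀 ≈ₚ pos (Edge.tgt e)
    avoids        : ∀ e {v} → v ∈ V → pos v On curve e → v ∈ₑ e
    finite        : ∀ {e f} → e ≢ f → Finite (λ p → p On curve e × p On curve f)
    not-tangent   : ∀ {e f} → e ≢ f → ∀ p → Crossing e f p →
                    ¬ Tangent (curve e) (curve f) p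
    no-triple     : ∀ {e f g} → e ≢ f → e ≢ g → f ≢ g → ∀ p →
                    p On curve e → p On curve f → p On curve g →
                    ∃[ v ] (v ∈ₑ e × v ∈ₑ f × v ∈ₑ g × pos v ≈ₚ p)

  CrossingAlong : Edge G → Point → Set
  CrossingAlong e p = ∃[ f ] (e ≢ f × Crossing e f p)

------------------------------------------------------------------------
-- Local crossing numbers

IsMinimum : ∀ {ℓ} → (ℕ → Set ℓ) → ℕ → Set ℓ
IsMinimum P m = P m × (∀ l → P l → m ℕ.≤ l)

DrawableWith : ∀ {n} → Graph n → ℕ → Set
DrawableWith G L = Σ[ D ∈ Drawing G ] (∀ e → AtMost L (Drawing.CrossingAlong D e))

-- Minima over undecidable predicates cannot be computed, so local crossing
-- numbers are given by their graphs: IsLcr G L says lcr(G) = L.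
IsLcr : ∀ {n} → Graph n → ℕ → Set
IsLcr G = IsMinimum (DrawableWith G)

max : ∀ {k} → Vector ℕ k → ℕ
max = foldr ℕ._⊔_ 0

record Cover (k : ℕ) {n : ℕ} (G : Graph n) : Set₁ where
  field
    part     : Fin k → Graph n
    subgraph : ∀ i → part i ⊑ G
    union    : ∀ u v → Graph._~_ G u v ⇔ (∃[ i ] Graph._~_ (part i) u v)

-- IsLcrₖ k G m says lcrₖ(G) = m.
IsLcrₖ : ℕ → ∀ {n} → Graph n → ℕ → Set₁
IsLcrₖ k G = IsMinimum λ m →
  Σ[ C ∈ Cover k G ] Σ[ l ∈ Vector ℕ k ] ((∀ i → IsLcr (Cover.part C i) (l i)) × m ≡ max l)

{-# OPTIONS --safe #-}
-- Give the edges of G k colours so that, in an optimal drawing, as few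
-- crossings as possible are between edges of the same colour.  Recolouring a
-- single edge cannot help, so each edge crosses its own colour class at most
-- as often as any other, hence at most lcr(G)/k times.  The classes with the
-- inherited drawings give lcrₖ(G) ≤ lcr(G)/k, which is stronger than the
-- claim.  The goal is a negation, so classical logic is available under ¬ ¬.
module Submission where

open import Defs
open import Data.Nat.Base using (ℕ; NonZero)
open import Data.Integer.Base using (+_)
import Data.Rational.Base as ℚ

open import Data.Bool.Base using (if_then_else_)
open import Data.Fin.Base as Fin using (Fin; zero; suc; combine; punchIn)
open import Data.Fin.Properties as Finₚ using (combine-injective; punchInᵢ≢i)
import Data.Integer.Base as ℤ
import Data.Integer.Properties as ℤₚ
open import Data.List.Base using (List; []; _∷_; _++_; length)
open import Data.List.Properties using (length-++)
open import Data.List.Relation.Unary.Any using (Any; here; there)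
open import Data.List.Relation.Unary.Any.Properties using (++⁺ˡ; ++⁺ʳ)
import Data.Nat.Base as ℕ
open import Data.Nat.Base using (zero; suc)
open import Data.Nat.DivMod using (m*n/n≡m; /-monoˡ-≤; m/n*n≤m)
open import Data.Nat.Induction using (<-rec)
import Data.Nat.Properties as ℕₚ
open import Data.Product.Base using (∃-syntax; Σ-syntax; _×_; _,_; proj₁; proj₂; swap)
import Data.Rational.Properties as ℚₚ
import Data.Rational.Unnormalised.Base as ℚᵘ
import Data.Rational.Unnormalised.Properties as ℚᵘₚ
open import Data.Rational.Solver using (module +-*-Solver)
open import Data.Sum.Base using (_⊎_; inj₁; inj₂)
import Data.Sum.Base as Sum
open import Data.Vec.Functional using (Vector; removeAt; updateAt)
open import Data.Vec.Functional.Properties using (updateAt-updates; updateAt-minimal)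
open import Effect.Monad using (RawMonad)
open import Function.Base using (_∘_; const; id)
open import Function.Bundles using (mk⇔)
open import Level using (0ℓ)
open import Relation.Binary.Definitions using (tri<; tri≈; tri>)
open import Relation.Binary.PropositionalEquality
open import Relation.Nullary.Decidable using (dec-true; dec-false)
open import Relation.Nullary.Decidable.Core
  using (yes; no; does; recompute; ¬¬-excluded-middle; _×-dec_; _⊎-dec_)
open import Relation.Nullary.Negation using (¬_; ¬¬-Monad; contradiction)

open import Algebra.Properties.Semiring.Sum ℕₚ.+-*-semiring
  using (sum; sum-remove; sum-cong-≗; sum-replicate-zero; ∑-comm; ∑-distrib-+; *-distribʳ-sum)
open RawMonad (¬¬-Monad {0ℓ}) using (pure; _>>=_; rawApplicative)

-- Double negation, minima and finite sums.

¬¬-Π : ∀ {n} {P : Fin n → Set} → (∀ i → ¬ ¬ P i) → ¬ ¬ (∀ i → P i)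
¬¬-Π = Finₚ.sequence rawApplicative

-- If there were no minimum, strong induction would refute `P` at every number, in particular at
-- `m`.
¬¬-minimum : {P : ℕ → Set} → ∀ {m} → P m → ¬ ¬ (∃[ l ] IsMinimum P l)
¬¬-minimum {P} {m} p none = <-rec (λ l → ¬ P l)
  (λ l rec pl → none (l , pl , λ l′ pl′ → ℕₚ.≮⇒≥ λ l′<l → rec l′<l pl′)) m p

*≤sum : ∀ {k m} (f : Vector ℕ k) → (∀ a → m ℕ.≤ f a) → k ℕ.* m ℕ.≤ sum f
*≤sum {zero}  f m≤f = ℕ.z≤n
*≤sum {suc k} f m≤f = ℕₚ.+-mono-≤ (m≤f zero) (*≤sum (f ∘ suc) (m≤f ∘ suc))

sum-mono-≤ : ∀ {n} (f g : Vector ℕ n) → (∀ i → f i ℕ.≤ g i) → sum f ℕ.≤ sum g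
sum-mono-≤ {zero}  f g f≤g = ℕ.z≤n
sum-mono-≤ {suc n} f g f≤g = ℕₚ.+-mono-≤ (f≤g zero) (sum-mono-≤ (f ∘ suc) (g ∘ suc) (f≤g ∘ suc))

sum-zero : ∀ {n} (f : Vector ℕ n) → (∀ i → f i ≡ 0) → sum f ≡ 0
sum-zero {n} f f≡0 = trans (sum-cong-≗ f≡0) (sum-replicate-zero n)

δ : ∀ {k} → Fin k → Fin k → ℕ
δ a b = if does (a Finₚ.≟ b) then 1 else 0

δ-refl : ∀ {k} (a : Fin k) → δ a a ≡ 1
δ-refl a = cong (if_then 1 else 0) (dec-true (a Finₚ.≟ a) refl)

δ-≢ : ∀ {k} {a b : Fin k} → a ≢ b → δ a b ≡ 0
δ-≢ {a = a} {b} a≢b = cong (if_then 1 else 0) (dec-false (a Finₚ.≟ b) a≢b)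

δ-sym : ∀ {k} (a b : Fin k) → δ a b ≡ δ b a
δ-sym a b with a Finₚ.≟ b
... | yes refl = sym (δ-refl a)
... | no a≢b   = sym (δ-≢ (a≢b ∘ sym))

sum-δ : ∀ {k} (b : Fin k) → sum (λ a → δ a b) ≡ 1
sum-δ {suc k} b = trans (sum-remove {i = b} (λ a → δ a b))
  (cong₂ ℕ._+_ (δ-refl b) (sum-zero _ λ a → δ-≢ (punchInᵢ≢i b a)))

-- Row i and column i have the same sum, and the diagonal vanishes, so the
-- total is twice the sum of row i plus what A and B have in common.
row-≤ : ∀ {n} (A B : Fin n → Fin n → ℕ) →
  (∀ p q → A p q ≡ A q p) → (∀ p q → B p q ≡ B q p) →
  (∀ p → A p p ≡ 0) → (∀ p → B p p ≡ 0) →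
  ∀ i → (∀ p q → p ≢ i → q ≢ i → A p q ≡ B p q) →
  sum (sum ∘ A) ℕ.≤ sum (sum ∘ B) → sum (A i) ℕ.≤ sum (B i)
row-≤ {suc n} A B A-sym B-sym A-diag B-diag i A≡B ΣA≤ΣB = ℕₚ.≮⇒≥ λ B<A →
  ℕₚ.<⇒≱ (begin-strict
    sum (sum ∘ B)                                ≡⟨ isolate B B-sym B-diag ⟩
    sum (B i) ℕ.+ (sum (B i) ℕ.+ others B)       <⟨ ℕₚ.+-mono-<-≤ B<A (ℕₚ.+-monoˡ-≤ _ (ℕₚ.<⇒≤ B<A)) ⟩
    sum (A i) ℕ.+ (sum (A i) ℕ.+ others B)       ≡⟨ cong (λ r → sum (A i) ℕ.+ (sum (A i) ℕ.+ r)) others-≡ ⟨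
    sum (A i) ℕ.+ (sum (A i) ℕ.+ others A)       ≡⟨ isolate A A-sym A-diag ⟨
    sum (sum ∘ A) ∎) ΣA≤ΣB
  where
  open ℕₚ.≤-Reasoning

  others : (Fin (suc n) → Fin (suc n) → ℕ) → ℕ
  others X = sum (λ p → sum (λ q → X (punchIn i p) (punchIn i q)))

  others-≡ : others A ≡ others B
  others-≡ = sum-cong-≗ λ p → sum-cong-≗ λ q →
    A≡B (punchIn i p) (punchIn i q) (punchInᵢ≢i i p) (punchInᵢ≢i i q)

  module _ (X : Fin (suc n) → Fin (suc n) → ℕ)
           (X-sym : ∀ p q → X p q ≡ X q p) (X-diag : ∀ p → X p p ≡ 0) where

    column : sum (λ p → X (punchIn i p) i) ≡ sum (X i)
    column = begin-equality
      sum (λ p → X (punchIn i p) i)     ≡⟨ sum-cong-≗ (λ p → X-sym (punchIn i p) i) ⟩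
      sum (removeAt (X i) i)            ≡⟨ cong (ℕ._+ sum (removeAt (X i) i)) (X-diag i) ⟨
      X i i ℕ.+ sum (removeAt (X i) i)  ≡⟨ sum-remove {i = i} (X i) ⟨
      sum (X i) ∎

    isolate : sum (sum ∘ X) ≡ sum (X i) ℕ.+ (sum (X i) ℕ.+ others X)
    isolate = begin-equality
      sum (sum ∘ X)
        ≡⟨ sum-remove {i = i} (sum ∘ X) ⟩
      sum (X i) ℕ.+ sum (λ p → sum (X (punchIn i p)))
        ≡⟨ cong (sum (X i) ℕ.+_) (sum-cong-≗ λ p → sum-remove {i = i} (X (punchIn i p))) ⟩
      sum (X i) ℕ.+ sum (λ p → X (punchIn i p) i ℕ.+ sum (removeAt (X (punchIn i p)) i))
        ≡⟨ cong (sum (X i) ℕ.+_)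
             (∑-distrib-+ (λ p → X (punchIn i p) i) (λ p → sum (removeAt (X (punchIn i p)) i))) ⟩
      sum (X i) ℕ.+ (sum (λ p → X (punchIn i p) i) ℕ.+ others X)
        ≡⟨ cong (λ s → sum (X i) ℕ.+ (s ℕ.+ others X)) column ⟩
      sum (X i) ℕ.+ (sum (X i) ℕ.+ others X) ∎

-- Balanced colourings of a weighted graph.

module _ {N k : ℕ} (W : Fin N → Fin N → ℕ) where

  degree : (Fin N → Fin k) → Fin N → Fin k → ℕ
  degree c i a = sum (λ j → δ a (c j) ℕ.* W i j)

  -- Ordered pairs are summed, so for symmetric `W` with zero diagonal this is twice the
  -- monochromatic weight.
  energy : (Fin N → Fin k) → ℕ
  energy c = sum (λ i → degree c i (c i))

  -- After exchanging the sums, each `j` contributes for exactly one colour, its own.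
  sum-degree : ∀ c i → sum (degree c i) ≡ sum (W i)
  sum-degree c i = begin
    sum (λ a → sum (λ j → δ a (c j) ℕ.* W i j))  ≡⟨ ∑-comm (λ a j → δ a (c j) ℕ.* W i j) ⟩
    sum (λ j → sum (λ a → δ a (c j) ℕ.* W i j))  ≡⟨ sum-cong-≗ (λ j → *-distribʳ-sum (W i j) (λ a → δ a (c j))) ⟨
    sum (λ j → sum (λ a → δ a (c j)) ℕ.* W i j)
      ≡⟨ sum-cong-≗ (λ j → trans (cong (ℕ._* W i j) (sum-δ (c j))) (ℕₚ.*-identityˡ (W i j))) ⟩
    sum (W i) ∎
    where open ≡-Reasoning


module _ {N : ℕ} (W : Fin N → Fin N → ℕ)
         (W-sym : ∀ i j → W i j ≡ W j i) (W-diag : ∀ i → W i i ≡ 0) where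

  -- Giving `i` the colour `a` changes the matrix `A` of monochromatic weights only in row and
  -- column `i`, so minimality of the total passes to row `i` by `row-≤`.
  degree-minimal : ∀ {k} (c : Fin N → Fin k) → (∀ c′ → energy W c ℕ.≤ energy W c′) →
    ∀ i a → degree W c i (c i) ℕ.≤ degree W c i a
  degree-minimal {k} c c-min i a = begin
    degree W c i (c i)    ≤⟨ row-≤ (A c) (A c′) (A-sym c) (A-sym c′) (A-diag c) (A-diag c′) i A≡A′ (c-min c′) ⟩
    degree W c′ i (c′ i)  ≡⟨ sum-cong-≗ row ⟩
    degree W c i a        ∎
    where
    open ℕₚ.≤-Reasoning

    c′ : Fin N → Fin k
    c′ = updateAt c i (const a)

    A : (Fin N → Fin k) → Fin N → Fin N → ℕ
    A c p q = δ (c p) (c q) ℕ.* W p q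

    A-sym : ∀ c p q → A c p q ≡ A c q p
    A-sym c p q = cong₂ ℕ._*_ (δ-sym (c p) (c q)) (W-sym p q)

    A-zero : ∀ x {p q} → p ≡ q → x ℕ.* W p q ≡ 0
    A-zero x {p} refl = trans (cong (x ℕ.*_) (W-diag p)) (ℕₚ.*-zeroʳ x)

    A-diag : ∀ c p → A c p p ≡ 0
    A-diag c p = A-zero (δ (c p) (c p)) refl

    A≡A′ : ∀ p q → p ≢ i → q ≢ i → A c p q ≡ A c′ p q
    A≡A′ p q p≢i q≢i = cong (ℕ._* W p q)
      (sym (cong₂ δ (updateAt-minimal p i c p≢i) (updateAt-minimal q i c q≢i)))

    row : ∀ j → A c′ i j ≡ δ a (c j) ℕ.* W i j
    row j with j Finₚ.≟ i
    -- Here `c′ j` is `a` while `c j` may differ, but `W i i` is 0 and both sides vanish.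
    ... | yes j≡i = trans (A-zero (δ (c′ i) (c′ j)) (sym j≡i)) (sym (A-zero (δ a (c j)) (sym j≡i)))
    ... | no j≢i  = cong (ℕ._* W i j) (cong₂ δ (updateAt-updates i c) (updateAt-minimal j i c j≢i))

  -- At a colouring of least energy, the degree of `i` into its own colour is the smallest of `k`
  -- numbers with total `sum (W i)`, hence at most their average.
  balanced-colouring : ∀ k → .{{NonZero k}} →
    ¬ ¬ (∃[ c ] (∀ i → k ℕ.* degree {k = k} W c i (c i) ℕ.≤ sum (W i)))
  balanced-colouring k@(suc _) = do
    (m , (c , c≡m) , c-min) ← ¬¬-minimum {λ m → ∃[ c ] energy W c ≡ m} (const zero , refl)
    pure (c , λ i → ℕₚ.≤-trans
      (*≤sum (degree W c i) (degree-minimal c 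
        (λ c′ → subst (ℕ._≤ energy W c′) (sym c≡m) (c-min _ (c′ , refl))) i))
      (ℕₚ.≤-reflexive (sum-degree W c i)))

-- Order on the reals and equality of points.

p≤∣p∣ : ∀ p → p ℚ.≤ ℚ.∣ p ∣
p≤∣p∣ p with ℚₚ.≤-total ℚ.0ℚ p
... | inj₁ 0≤p = ℚₚ.≤-reflexive (sym (ℚₚ.0≤p⇒∣p∣≡p 0≤p))
... | inj₂ p≤0 = ℚₚ.≤-trans p≤0 (ℚₚ.0≤∣p∣ p)

-- A gap at one index suffices: beyond the Cauchy moduli each sequence drifts by at most `η`, so of
-- the four `η` at `K` two survive at all later indices.
seq-<⇒< : ∀ x y {η} → ℚ.0ℚ ℚ.< η →
  ∃[ M ] (∀ K → M ℕ.≤ K → seq x K ℚ.+ (η ℚ.+ η ℚ.+ (η ℚ.+ η)) ℚ.≤ seq y K → x < y)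
seq-<⇒< x y {η} 0<η with cauchy x η 0<η | cauchy y η 0<η
... | M , xM | M′ , yM′ = M ℕ.⊔ M′ , λ K ≤K gap →
  η ℚ.+ η , ℚₚ.+-mono-< 0<η 0<η , K , λ n K≤n → begin
    seq x n ℚ.+ (η ℚ.+ η)
      ≡⟨ solve 3 (λ a b e → a :+ (e :+ e) := (a :- b) :+ (b :+ (e :+ e))) refl (seq x n) (seq x K) η ⟩
    (seq x n ℚ.- seq x K) ℚ.+ (seq x K ℚ.+ (η ℚ.+ η))
      ≤⟨ ℚₚ.+-monoˡ-≤ _ (close (xM n K (ℕₚ.≤-trans (left ≤K) K≤n) (left ≤K))) ⟩
    η ℚ.+ (seq x K ℚ.+ (η ℚ.+ η))
      ≡⟨ solve 2 (λ b e → e :+ (b :+ (e :+ e)) := (b :+ (e :+ e :+ (e :+ e))) :- e) refl (seq x K) η ⟩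
    (seq x K ℚ.+ (η ℚ.+ η ℚ.+ (η ℚ.+ η))) ℚ.- η
      ≤⟨ ℚₚ.+-mono-≤ gap (ℚₚ.neg-antimono-≤ (close (yM′ K n (right ≤K) (ℕₚ.≤-trans (right ≤K) K≤n)))) ⟩
    seq y K ℚ.- (seq y K ℚ.- seq y n)
      ≡⟨ solve 2 (λ a b → a :- (a :- b) := b) refl (seq y K) (seq y n) ⟩
    seq y n ∎
  where
  open ℚₚ.≤-Reasoning
  open +-*-Solver
  close : ∀ {p} → ℚ.∣ p ∣ ℚ.≤ η → p ℚ.≤ η
  close {p} = ℚₚ.≤-trans (p≤∣p∣ p)
  left : ∀ {K} → M ℕ.⊔ M′ ℕ.≤ K → M ℕ.≤ K
  left = ℕₚ.≤-trans (ℕₚ.m≤m⊔n M M′)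
  right : ∀ {K} → M ℕ.⊔ M′ ℕ.≤ K → M′ ℕ.≤ K
  right = ℕₚ.≤-trans (ℕₚ.m≤n⊔m M M′)

-- As `_≤_` is a negation, `z < x` has to be turned into `y < x` or `z < y`. Comparing rationals at
-- a single late index decides which.
≤-trans : ∀ {x y z} → x ≤ y → y ≤ z → x ≤ z
≤-trans {x} {y} {z} x≤y y≤z (δ , 0<δ , N , z+δ≤x) = impossible (ℚₚ.≤-total (seq y K ℚ.+ 4η) (seq x K))
  where
  open ℚₚ.≤-Reasoning
  open +-*-Solver

  η 4η : ℚ.ℚ
  -- This makes `4η` half of `δ`: if `seq y K` is not `4η` below `seq x K`, then `seq z K` is `4η`
  -- below `seq y K`.
  η  = + 1 ℚ./ 8 ℚ.* δ
  4η = η ℚ.+ η ℚ.+ (η ℚ.+ η)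

  0<η : ℚ.0ℚ ℚ.< η
  0<η = ℚₚ.positive⁻¹ η {{ℚₚ.pos*pos⇒pos (+ 1 ℚ./ 8) δ {{ℚ.positive 0<δ}}}}

  M M′ K : ℕ
  M  = proj₁ (seq-<⇒< y x 0<η)
  M′ = proj₁ (seq-<⇒< z y 0<η)
  K  = N ℕ.⊔ (M ℕ.⊔ M′)

  M⊔M′≤K : M ℕ.⊔ M′ ℕ.≤ K
  M⊔M′≤K = ℕₚ.m≤n⊔m N (M ℕ.⊔ M′)

  impossible : ¬ (seq y K ℚ.+ 4η ℚ.≤ seq x K ⊎ seq x K ℚ.≤ seq y K ℚ.+ 4η)
  impossible (inj₁ y+4η≤x) =
    x≤y (proj₂ (seq-<⇒< y x 0<η) K (ℕₚ.≤-trans (ℕₚ.m≤m⊔n M M′) M⊔M′≤K) y+4η≤x)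
  impossible (inj₂ x≤y+4η) =
    y≤z (proj₂ (seq-<⇒< z y 0<η) K (ℕₚ.≤-trans (ℕₚ.m≤n⊔m M M′) M⊔M′≤K) (begin
      seq z K ℚ.+ 4η
        ≡⟨ solve 2 (λ a d → let e = con (+ 1 ℚ./ 8) :* d ; q = e :+ e :+ (e :+ e) in
             a :+ q := (a :+ d) :- q) refl (seq z K) δ ⟩
      (seq z K ℚ.+ δ) ℚ.- 4η
        ≤⟨ ℚₚ.+-monoˡ-≤ (ℚ.- 4η) (ℚₚ.≤-trans (z+δ≤x K (ℕₚ.m≤m⊔n N (M ℕ.⊔ M′))) x≤y+4η) ⟩
      (seq y K ℚ.+ 4η) ℚ.- 4η
        ≡⟨ solve 2 (λ a q → (a :+ q) :- q := a) refl (seq y K) 4η ⟩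
      seq y K ∎))

≈ₚ-sym : ∀ {p q} → p ≈ₚ q → q ≈ₚ p
≈ₚ-sym (x≈ , y≈) = swap x≈ , swap y≈

≈ₚ-trans : ∀ {p q r} → p ≈ₚ q → q ≈ₚ r → p ≈ₚ r
≈ₚ-trans {x , y} {x′ , y′} {x″ , y″} ((a , b) , (c , d)) ((a′ , b′) , (c′ , d′)) =
  ( ≤-trans {x} {x′} {x″} a a′ , ≤-trans {x″} {x′} {x} b′ b) ,
  ( ≤-trans {y} {y′} {y″} c c′ , ≤-trans {y″} {y′} {y} d′ d)

On-resp-≈ₚ : ∀ {γ p q} → p ≈ₚ q → p On γ → q On γ
On-resp-≈ₚ {γ} {p} {q} p≈q (t , γt≈p) = t , ≈ₚ-trans {at γ t} {p} {q} γt≈p p≈q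

-- Lists covering sets of points.

AtMost-mono : ∀ {l m} {P Q : Point → Set} → l ℕ.≤ m → (∀ p → Q p → P p) → AtMost l P → AtMost m Q
AtMost-mono l≤m Q⊆P (ps , ps≤l , covers) = ps , ℕₚ.≤-trans ps≤l l≤m , λ p q → covers p (Q⊆P p q)

AtMost-∅ : ∀ {m} {P : Point → Set} → (∀ p → ¬ P p) → AtMost m P
AtMost-∅ ∅ = [] , ℕ.z≤n , λ p Pp → contradiction Pp (∅ p)

AtMost-⋃ : ∀ {n} (m : Vector ℕ n) (P : Fin n → Point → Set) → (∀ j → AtMost (m j) (P j)) →
  AtMost (sum m) (λ p → ∃[ j ] P j p)
AtMost-⋃ {zero}  m P h = AtMost-∅ λ { _ (() , _) }
AtMost-⋃ {suc n} m P h with h zero | AtMost-⋃ (m ∘ suc) (P ∘ suc) (h ∘ suc)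
... | ps , ps≤ , ps-covers | qs , qs≤ , qs-covers =
  ps ++ qs , ℕₚ.≤-trans (ℕₚ.≤-reflexive (length-++ ps)) (ℕₚ.+-mono-≤ ps≤ qs≤) , λ
    { p (zero , Pp)  → ++⁺ˡ (ps-covers p Pp)
    ; p (suc j , Pp) → ++⁺ʳ ps (qs-covers p (j , Pp)) }

sum-length-cons : ∀ {n} (qs : Fin n → List Point) j x →
  sum (length ∘ updateAt qs j (x ∷_)) ≡ suc (sum (length ∘ qs))
sum-length-cons qs zero    x = refl
sum-length-cons qs (suc j) x = trans (cong (length (qs zero) ℕ.+_) (sum-length-cons (qs ∘ suc) j x))
  (ℕₚ.+-suc (length (qs zero)) _)

Disjoint : ∀ {n} → (Fin n → Point → Set) → Set
Disjoint P = ∀ {i j p q} → P i p → P j q → p ≈ₚ q → i ≡ j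

-- Each listed point is handed to the one set that contains it up to `_≈ₚ_`, if there is one; by
-- disjointness no other set needs it. Membership is undecidable, hence the double negation.
distribute : ∀ {n} {P : Fin n → Point → Set} → Disjoint P → ∀ ps →
  ¬ ¬ (Σ[ qs ∈ (Fin n → List Point) ] (sum (length ∘ qs) ℕ.≤ length ps ×
    (∀ j p → P j p → Any (p ≈ₚ_) ps → Any (p ≈ₚ_) (qs j))))
distribute {n} disjoint [] =
  pure (const [] , ℕₚ.≤-reflexive (sum-zero {n} (const 0) λ _ → refl) , λ _ _ _ ())
distribute {P = P} disjoint (x ∷ ps) = do
  (qs , qs≤ , covers) ← distribute disjoint ps
  -- `P` need not respect `_≈ₚ_`, so the test is for some `q` in `P i` equal to `x`, not for `x`
  -- itself.
  yes (i , q , Piq , q≈x) ← ¬¬-excluded-middle {A = ∃[ i ] ∃[ q ] (P i q × q ≈ₚ x)}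
    where no unused → pure (qs , ℕₚ.m≤n⇒m≤1+n qs≤ , λ
            { j p Pjp (here p≈x)   → contradiction (j , p , Pjp , p≈x) unused
            ; j p Pjp (there p∈ps) → covers j p Pjp p∈ps })
  pure (updateAt qs i (x ∷_)
       , ℕₚ.≤-trans (ℕₚ.≤-reflexive (sum-length-cons qs i x)) (ℕ.s≤s qs≤)
       , λ { j p Pjp p∈ → extend qs i q Piq q≈x j p Pjp p∈ (covers j p Pjp) })
  where
  extend : ∀ qs i q → P i q → q ≈ₚ x → ∀ j p → P j p → Any (p ≈ₚ_) (x ∷ ps) →
    (Any (p ≈ₚ_) ps → Any (p ≈ₚ_) (qs j)) → Any (p ≈ₚ_) (updateAt qs i (x ∷_) j)
  extend qs i q Piq q≈x j p Pjp p∈ covers with j Finₚ.≟ i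
  extend qs i q Piq q≈x i p Pip (here p≈x) covers | yes refl =
    subst (Any (p ≈ₚ_)) (sym (updateAt-updates i qs)) (here p≈x)
  extend qs i q Piq q≈x i p Pip (there p∈ps) covers | yes refl =
    subst (Any (p ≈ₚ_)) (sym (updateAt-updates i qs)) (there (covers p∈ps))
  extend qs i q Piq q≈x j p Pjp (here p≈x) covers | no j≢i =
    contradiction (disjoint Pjp Piq (≈ₚ-trans {p} {x} {q} p≈x (≈ₚ-sym {q} {x} q≈x))) j≢i
  extend qs i q Piq q≈x j p Pjp (there p∈ps) covers | no j≢i =
    subst (Any (p ≈ₚ_)) (sym (updateAt-minimal j i qs j≢i)) (covers p∈ps)

≤-/ : ∀ {k m L} .{{_ : NonZero k}} → k ℕ.* m ℕ.≤ L → m ℕ.≤ L ℕ./ k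
≤-/ {k} {m} {L} km≤L = begin
  m              ≡⟨ m*n/n≡m m k ⟨
  m ℕ.* k ℕ./ k  ≤⟨ /-monoˡ-≤ k (ℕₚ.≤-trans (ℕₚ.≤-reflexive (ℕₚ.*-comm m k)) km≤L) ⟩
  L ℕ./ k        ∎
  where open ℕₚ.≤-Reasoning

-- The lists covering the crossings along different edges are unrelated; taking
-- the least size of a cover of X i j as its weight makes the weights symmetric.
split-conflicts : ∀ {N L} k .{{_ : NonZero k}} (X : Fin N → Fin N → Point → Set) →
  (∀ {i j p} → X i j p → X j i p) → (∀ {i p} → ¬ X i i p) → (∀ i → Disjoint (X i)) →
  (∀ i → AtMost L (λ p → ∃[ j ] X i j p)) →
  ¬ ¬ (Σ[ c ∈ (Fin N → Fin k) ] (∀ i → AtMost (L ℕ./ k) (λ p → ∃[ j ] (c i ≡ c j × X i j p))))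
split-conflicts {N} {L} k X X-sym X-irrefl X-disjoint X≤L = do
  w ← ¬¬-Π λ i → ¬¬-Π λ j → ¬¬-minimum {λ m → AtMost m (X i j)}
        (AtMost-mono ℕₚ.≤-refl (λ _ Xij → j , Xij) (X≤L i))
  let W : Fin N → Fin N → ℕ
      W i j = proj₁ (w i j)
      covered : ∀ i j → AtMost (W i j) (X i j)
      covered i j = proj₁ (proj₂ (w i j))
      least : ∀ i j {m} → AtMost m (X i j) → W i j ℕ.≤ m
      least i j = proj₂ (proj₂ (w i j)) _
      W-≤ : ∀ i j → W i j ℕ.≤ W j i
      W-≤ i j = least i j (AtMost-mono ℕₚ.≤-refl (λ _ → X-sym) (covered j i))
      W-diag : ∀ i → W i i ≡ 0
      W-diag i = ℕₚ.n≤0⇒n≡0 (least i i (AtMost-∅ λ _ → X-irrefl))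
  -- A list covering all conflicts of `i` splits into covers of the disjoint sets `X i j`, and the
  -- weights are the least sizes of such covers.
  W≤L ← ¬¬-Π λ i → do
    let ps , ps≤L , ps-covers = X≤L i
    (qs , qs≤ps , qs-covers) ← distribute (X-disjoint i) ps
    pure (ℕₚ.≤-trans (sum-mono-≤ (W i) (length ∘ qs) λ j →
            least i j (qs j , ℕₚ.≤-refl , λ p Xp → qs-covers j p Xp (ps-covers p (j , Xp))))
          (ℕₚ.≤-trans qs≤ps ps≤L))
  (c , balanced) ← balanced-colouring W (λ i j → ℕₚ.≤-antisym (W-≤ i j) (W-≤ j i)) W-diag k
  pure (c , λ i → AtMost-mono (≤-/ {k} (ℕₚ.≤-trans (balanced i) (W≤L i))) (λ _ → id)
    -- Other colours get weight 0, so the sum of these weights is `degree W c i (c i)`, the number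
    -- bounded by `balanced`.
    (AtMost-⋃ (λ j → δ (c i) (c j) ℕ.* W i j) (λ j p → c i ≡ c j × X i j p)
      λ j → restrict-δ (c i) (c j) (covered i j)))
  where
  restrict-δ : ∀ {m P} (a b : Fin k) → AtMost m P → AtMost (δ a b ℕ.* m) (λ p → a ≡ b × P p)
  restrict-δ {m} a b P≤m with a Finₚ.≟ b
  ... | yes _  = AtMost-mono (ℕₚ.≤-reflexive (sym (ℕₚ.*-identityˡ m))) (λ _ → proj₂) P≤m
  ... | no a≢b = AtMost-∅ λ { _ (a≡b , _) → a≢b a≡b }

-- Colour classes as subgraphs with inherited drawings.

module _ {n : ℕ} {G : Graph n} where

  index : Edge G → Fin (n ℕ.* n)
  index e = combine (Edge.src e) (Edge.tgt e)

  -- The proofs stored in an `Edge` are irrelevant, so equal endpoints already give equal edges.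
  index-injective : ∀ {e f} → index e ≡ index f → e ≡ f
  index-injective {mkEdge a b _ _} {mkEdge a′ b′ _ _} eq
    with refl , refl ← combine-injective a b a′ b′ eq = refl

module _ {n k : ℕ} (G : Graph n) (c : Fin (n ℕ.* n) → Fin k) (i : Fin k) where
  open Graph G

  -- Only the values of c at pairs u < v matter.
  _~ᶜ_ : Fin n → Fin n → Set
  u ~ᶜ v = u Fin.< v × c (combine u v) ≡ i ⊎ v Fin.< u × c (combine v u) ≡ i

  colourClass : Graph n
  colourClass = record
    { V        = V
    ; _~_      = λ u v → u ~ v × u ~ᶜ v
    ; _~?_     = λ u v → (u ~? v) ×-dec
        ((u Finₚ.<? v) ×-dec (c (combine u v) Finₚ.≟ i) ⊎-dec
         (v Finₚ.<? u) ×-dec (c (combine v u) Finₚ.≟ i))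
    ; ~-sym    = λ (u~v , col) → ~-sym u~v , Sum.swap col
    ; ~-irrefl = λ u≡v (u~v , _) → ~-irrefl u≡v u~v
    ; ~⇒∈V     = λ (u~v , _) → ~⇒∈V u~v
    }

  colourClass-⊑ : colourClass ⊑ G
  colourClass-⊑ = record { V⊆V = id ; ~⇒~ = proj₁ }

  include : Edge colourClass → Edge G
  include (mkEdge u v u<v u~v) = mkEdge u v u<v (proj₁ u~v)

  include-injective : ∀ {e f} → include e ≡ include f → e ≡ f
  include-injective refl = refl

  include-colour : ∀ e → c (index (include e)) ≡ i
  include-colour (mkEdge u v u<v u~v) =
    -- The adjacency proof of an edge is irrelevant; decidable equality of colours recovers a usable
    -- equation from it.
    recompute (c (combine u v) Finₚ.≟ i) (ascending u<v (proj₂ u~v))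
    where
    ascending : u Fin.< v → u ~ᶜ v → c (combine u v) ≡ i
    ascending u<v (inj₁ (_ , col))  = col
    ascending u<v (inj₂ (v<u , _)) = contradiction v<u (ℕₚ.<-asym u<v)

  restrict : Drawing G → Drawing colourClass
  restrict D = record
    { pos           = pos
    ; curve         = curve ∘ include
    ; pos-injective = pos-injective
    ; starts        = starts ∘ include
    ; ends          = ends ∘ include
    ; avoids        = λ e → avoids (include e)
    ; finite        = λ e≢f → finite (e≢f ∘ include-injective)
    ; not-tangent   = λ e≢f → not-tangent (e≢f ∘ include-injective)
    ; no-triple     = λ e≢f e≢g f≢g → no-triple
        (e≢f ∘ include-injective) (e≢g ∘ include-injective) (f≢g ∘ include-injective)
    }
    where open Drawing D

colourCover : ∀ {n k} (G : Graph n) → (Fin (n ℕ.* n) → Fin k) → Cover k G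
colourCover G c = record
  { part     = colourClass G c
  ; subgraph = colourClass-⊑ G c
  ; union    = λ u v → mk⇔ (coloured u v) (λ (_ , u~v , _) → u~v)
  }
  where
  open Graph G
  coloured : ∀ u v → u ~ v → ∃[ i ] (u ~ v × _~ᶜ_ G c i u v)
  coloured u v u~v with Finₚ.<-cmp u v
  ... | tri< u<v _ _ = c (combine u v) , u~v , inj₁ (u<v , refl)
  ... | tri≈ _ u≡v _ = contradiction u~v (~-irrefl u≡v)
  ... | tri> _ _ v<u = c (combine v u) , u~v , inj₂ (v<u , refl)

-- Conflicts between the edges of a drawing.

module _ {n : ℕ} {G : Graph n} (D : Drawing G) where
  open Drawing D

  -- Conflicts are indexed by pairs of vertices, that is, by numbers below
  -- n * n; indices that are not edges have none.
  Conflict : Fin (n ℕ.* n) → Fin (n ℕ.* n) → Point → Set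
  Conflict i j p = Σ[ e ∈ Edge G ] Σ[ f ∈ Edge G ]
    (index e ≡ i × index f ≡ j × e ≢ f × Crossing e f p)

  Conflict-sym : ∀ {i j p} → Conflict i j p → Conflict j i p
  Conflict-sym (e , f , ei , fj , e≢f , on-e , on-f , no-end) =
    f , e , fj , ei , e≢f ∘ sym , on-f , on-e , λ (v , v∈f , v∈e , v≈p) → no-end (v , v∈e , v∈f , v≈p)

  Conflict-irrefl : ∀ {i p} → ¬ Conflict i i p
  Conflict-irrefl (e , f , ei , fi , e≢f , _) = e≢f (index-injective (trans ei (sym fi)))

  -- A point where `e` crosses both `f` and `g` lies on three edges. By `no-triple` it is a common
  -- endpoint of them, which a crossing of `e` and `f` is not.
  Conflict-disjoint : ∀ i → Disjoint (Conflict i)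
  Conflict-disjoint i {j} {j′} {p} {q}
    (e , f , ei , fj , e≢f , on-e , on-f , no-end) (e′ , g , ei′ , gj′ , e≢g , _ , on-g , _) p≈q
    with refl ← index-injective {e = e} {e′} (trans ei (sym ei′)) | j Finₚ.≟ j′
  ... | yes j≡j′ = j≡j′
  ... | no j≢j′  = contradiction (v , v∈e , v∈f , v≈p) no-end
    where
    f≢g : f ≢ g
    f≢g f≡g = j≢j′ (trans (sym fj) (trans (cong index f≡g) gj′))
    common : ∃[ v ] (v ∈ₑ e × v ∈ₑ f × v ∈ₑ g × pos v ≈ₚ p)
    common = no-triple e≢f e≢g f≢g p on-e on-f (On-resp-≈ₚ {curve g} {q} {p} (≈ₚ-sym {p} {q} p≈q) on-g)
    v    = proj₁ common
    v∈e  = proj₁ (proj₂ common)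
    v∈f  = proj₁ (proj₂ (proj₂ common))
    v≈p  = proj₂ (proj₂ (proj₂ (proj₂ common)))

  -- If `i` is the index of an edge, injectivity makes all its conflicts crossings along that edge;
  -- otherwise it has none. Classical logic decides between the cases.
  Conflict-AtMost : ∀ {L} → (∀ e → AtMost L (CrossingAlong e)) →
    ∀ i → ¬ ¬ AtMost L (λ p → ∃[ j ] Conflict i j p)
  Conflict-AtMost ≤L i = do
    yes (e , ei) ← ¬¬-excluded-middle {A = Σ[ e ∈ Edge G ] index e ≡ i}
      where no ∄e → pure (AtMost-∅ λ _ (_ , e , _ , ei , _) → ∄e (e , ei))
    pure (AtMost-mono ℕₚ.≤-refl (along e ei) (≤L e))
    where
    along : ∀ e → index e ≡ i → ∀ p → ∃[ j ] Conflict i j p → CrossingAlong e p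
    along e ei p (_ , e′ , f , ei′ , _ , e′≢f , cr)
      with refl ← index-injective {e = e} {e′} (trans ei (sym ei′)) = f , e′≢f , cr

-- A crossing along an edge of class `i` in the restricted drawing is a conflict in `D` between two
-- indices of colour `i`, and `split-conflicts` bounds these.
DrawableWith-colourClasses : ∀ k .{{_ : NonZero k}} {n L} {G : Graph n} → DrawableWith G L →
  ¬ ¬ (Σ[ c ∈ (Fin (n ℕ.* n) → Fin k) ] (∀ i → DrawableWith (colourClass G c i) (L ℕ./ k)))
DrawableWith-colourClasses k {G = G} (D , ≤L) = do
  conflicts≤L ← ¬¬-Π (Conflict-AtMost D ≤L)
  (c , ≤L/k) ← split-conflicts k (Conflict D)
    (λ {i} {j} {p} → Conflict-sym D {i} {j} {p}) (λ {i} {p} → Conflict-irrefl D {i} {p})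
    (Conflict-disjoint D) conflicts≤L
  pure (c , λ i → restrict G c i D , λ e → AtMost-mono ℕₚ.≤-refl
    (λ { p (f , e≢f , cr) → index (include G c i f)
       , trans (include-colour G c i e) (sym (include-colour G c i f))
       , include G c i e , include G c i f , refl , refl , e≢f ∘ include-injective G c i , cr })
    (≤L/k (index (include G c i e))))

-- Local crossing numbers and the real estimate.

max-≤ : ∀ {k m} (l : Vector ℕ k) → (∀ i → l i ℕ.≤ m) → max l ℕ.≤ m
max-≤ {zero}  l l≤m = ℕ.z≤n
max-≤ {suc k} l l≤m = ℕₚ.⊔-lub (l≤m zero) (max-≤ (l ∘ suc) (l≤m ∘ suc))

-- The colour classes form one of the covers over which `lcrₖ` is minimal; their own local crossing
-- numbers exist up to double negation.
lcrₖ≤lcr/k : ∀ k .{{_ : NonZero k}} {n} {G : Graph n} {lcr lcrₖ} →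
  IsLcr G lcr → IsLcrₖ k G lcrₖ → ¬ ¬ (lcrₖ ℕ.≤ lcr ℕ./ k)
lcrₖ≤lcr/k k {G = G} (drawable , _) (_ , lcrₖ-least) = do
  (c , drawableᵢ) ← DrawableWith-colourClasses k drawable
  lcrs ← ¬¬-Π λ i → ¬¬-minimum {DrawableWith (colourClass G c i)} (drawableᵢ i)
  pure (ℕₚ.≤-trans
    (lcrₖ-least _ (colourCover G c , proj₁ ∘ lcrs , proj₂ ∘ lcrs , refl))
    (max-≤ (proj₁ ∘ lcrs) λ i → proj₂ (proj₂ (lcrs i)) _ (drawableᵢ i)))

m*k≤L⇒m≤1/k*L : ∀ k .{{_ : NonZero k}} {m L} → m ℕ.* k ℕ.≤ L →
  + m ℚ./ 1 ℚ.≤ (+ 1 ℚ./ k) ℚ.* (+ L ℚ./ 1)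
-- Normalised fractions do not reduce for variable `k`; for unnormalised ones the inequality is a
-- cross-multiplication.
m*k≤L⇒m≤1/k*L k@(suc k-1) {m} {L} mk≤L = ℚₚ.toℚᵘ-cancel-≤ (begin
  ℚ.toℚᵘ (+ m ℚ./ 1)                               ≃⟨ ℚₚ.toℚᵘ-fromℚᵘ (ℚᵘ.mkℚᵘ (+ m) 0) ⟩
  ℚᵘ.mkℚᵘ (+ m) 0                                  ≤⟨ ℚᵘ.*≤* num ⟩
  ℚᵘ.mkℚᵘ (+ 1) k-1 ℚᵘ.* ℚᵘ.mkℚᵘ (+ L) 0
    ≃⟨ ℚᵘₚ.*-cong (ℚₚ.toℚᵘ-fromℚᵘ (ℚᵘ.mkℚᵘ (+ 1) k-1)) (ℚₚ.toℚᵘ-fromℚᵘ (ℚᵘ.mkℚᵘ (+ L) 0)) ⟨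
  ℚ.toℚᵘ (+ 1 ℚ./ k) ℚᵘ.* ℚ.toℚᵘ (+ L ℚ./ 1)       ≃⟨ ℚₚ.toℚᵘ-homo-* (+ 1 ℚ./ k) (+ L ℚ./ 1) ⟨
  ℚ.toℚᵘ ((+ 1 ℚ./ k) ℚ.* (+ L ℚ./ 1)) ∎)
  where
  open ℚᵘₚ.≤-Reasoning
  num : + m ℤ.* ℚᵘ.↧ (ℚᵘ.mkℚᵘ (+ 1) k-1 ℚᵘ.* ℚᵘ.mkℚᵘ (+ L) 0) ℤ.≤ (+ 1 ℤ.* + L) ℤ.* + 1
  num = subst₂ ℤ._≤_
    (trans (ℤₚ.pos-* m k) (cong (λ d → + m ℤ.* + d) (sym (ℕₚ.*-identityʳ k))))
    (sym (trans (ℤₚ.*-identityʳ (+ 1 ℤ.* + L)) (ℤₚ.*-identityˡ (+ L))))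
    (ℤ.+≤+ mk≤L)

-- The opposite strict inequality already fails at one index `K`, late enough for it to apply and
-- for `seq ε K` to be nonnegative.
fromℕ-≤-1/k+ε : ∀ k .{{_ : NonZero k}} {ε m L} → 0ℝ < ε → m ℕ.* k ℕ.≤ L →
  fromℕ m ≤ (fromℚ (+ 1 ℚ./ k) + ε) * fromℕ L
fromℕ-≤-1/k+ε k {ε} {m} {L} (η , 0<η , M , η≤ε) mk≤L (δ , 0<δ , N , below) =
  ℚₚ.<-irrefl refl (begin-strict
    + m ℚ./ 1
      ≤⟨ m*k≤L⇒m≤1/k*L k {m} mk≤L ⟩
    (+ 1 ℚ./ k) ℚ.* (+ L ℚ./ 1)
      ≤⟨ ℚₚ.*-monoʳ-≤-nonNeg (+ L ℚ./ 1) {{ℚₚ.normalize-nonNeg L 1}} 1/k≤1/k+ε ⟩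
    ((+ 1 ℚ./ k) ℚ.+ seq ε K) ℚ.* (+ L ℚ./ 1)
      ≡⟨ ℚₚ.+-identityʳ _ ⟨
    ((+ 1 ℚ./ k) ℚ.+ seq ε K) ℚ.* (+ L ℚ./ 1) ℚ.+ ℚ.0ℚ
      <⟨ ℚₚ.+-monoʳ-< (((+ 1 ℚ./ k) ℚ.+ seq ε K) ℚ.* (+ L ℚ./ 1)) 0<δ ⟩
    ((+ 1 ℚ./ k) ℚ.+ seq ε K) ℚ.* (+ L ℚ./ 1) ℚ.+ δ
      ≤⟨ below K (ℕₚ.m≤n⊔m M N) ⟩
    + m ℚ./ 1 ∎)
  where
  open ℚₚ.≤-Reasoning
  K : ℕ
  K = M ℕ.⊔ N
  0≤ε : ℚ.0ℚ ℚ.≤ seq ε K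
  0≤ε = begin
    ℚ.0ℚ         ≤⟨ ℚₚ.<⇒≤ 0<η ⟩
    η            ≡⟨ ℚₚ.+-identityˡ η ⟨
    ℚ.0ℚ ℚ.+ η   ≤⟨ η≤ε K (ℕₚ.m≤m⊔n M N) ⟩
    seq ε K ∎
  1/k≤1/k+ε : + 1 ℚ./ k ℚ.≤ (+ 1 ℚ./ k) ℚ.+ seq ε K
  1/k≤1/k+ε = begin
    + 1 ℚ./ k                ≡⟨ ℚₚ.+-identityʳ (+ 1 ℚ./ k) ⟨
    (+ 1 ℚ./ k) ℚ.+ ℚ.0ℚ     ≤⟨ ℚₚ.+-monoʳ-≤ (+ 1 ℚ./ k) 0≤ε ⟩
    (+ 1 ℚ./ k) ℚ.+ seq ε K ∎

theorem1p4 : (k : ℕ) .{{_ : NonZero k}} →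
    (ε : ℝ) (0<ε : 0ℝ < ε) → ε < fromℚ (+ 1 ℚ./ 10) →
    ∀ {n} (G : Graph n) (lcr lcrₖ : ℕ) → IsLcr G lcr → IsLcrₖ k G lcrₖ →
    (log[1/ε] : ℝ) → IsLog (1ℝ / ε by 0<ε) log[1/ε] →
    (fromℕ 10 * log[1/ε]) / (ε ^ 2) by (^-pos ε 2 0<ε) ≤ fromℕ lcr →
    fromℕ lcrₖ ≤ (fromℚ (+ 1 ℚ./ k) + ε) * fromℕ lcr
theorem1p4 k ε 0<ε _ G lcr lcrₖ isLcr isLcrₖ _ _ _ lcrₖ-exceeds =
  -- Rounding down in `lcr / k` is harmless, since the quotient times `k` is at most `lcr`.
  lcrₖ≤lcr/k k isLcr isLcrₖ λ lcrₖ≤ → fromℕ-≤-1/k+ε k {ε} {lcrₖ} {lcr} 0<ε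
    (ℕₚ.≤-trans (ℕₚ.*-monoˡ-≤ k lcrₖ≤) (m/n*n≤m lcr k)) lcrₖ-exceeds
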